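{- $\mathsf{EA} \to \mathsf{EPF}$. That is: given $\varphi : \mathbb{N} \to (\mathbb{N} \to \mathrm{option}\,\mathbb{N})$ such that for every $f : \mathbb{N} \to \mathrm{option}\,\mathbb{N}$ there exists $c$ with $\varphi\,c \equiv_{\mathsf{ran}} f$, one can construct $e : \mathbb{N} \to (\mathbb{N} \rightharpoonup \mathbb{N})$ such that for every partial function $f : \mathbb{N} \rightharpoonup \mathbb{N}$ there exists $n$ with $e\,n \equiv_{\mathbb{N} \rightharpoonup \mathbb{N}} f$.
   Context: Ambient theory: Coq's type theory (constructive, with a hierarchy of types $\mathbb{T}$ and a separate impredicative universe $\mathbb{P}$ of propositions), with no additional axioms. $\exists$ is propositional existence, $\Sigma$ the dependent pair type. Partial values: one assumes a type $\partial A$ for each type $A$, with a definedness relation $\triangleright : \partial A \to A \to \mathbb{P}$ satisfying $x \triangleright a_1 \to x \triangleright a_2 \to a_1 = a_2$, and operations: $\mathsf{ret} : A \to \partial A$ with $\mathsf{ret}\,a \triangleright a$; $\mathsf{undef} : \partial A$ with $\neg\exists a.\ \mathsf{undef} \triangleright a$; bind $\gg\!= \,: \partial A \to (A \to \partial B) \to \partial B$ with $(x \gg\!= f) \triangleright b \leftrightarrow \exists a.\ x \triangleright a \land f\,a \triangleright b$; $\mu : (\mathbb{N} \to \mathbb{B}) \to \partial \mathbb{N}$ with $\mu f \triangleright n \leftrightarrow f\,n = \mathsf{true} \land \forall m < n.\ f\,m = \mathsf{false}$; $\mathsf{seval} : \partial A \to \mathbb{N} \to \mathrm{option}\,A$ with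 $x \triangleright a \leftrightarrow \exists n.\ \mathsf{seval}\,x\,n = \mathrm{Some}\,a$. Write $A \rightharpoonup B$ for $A \to \partial B$, and $f \equiv_{A \rightharpoonup B} g := \forall x.\,\forall b.\ f\,x \triangleright b \leftrightarrow g\,x \triangleright b$. $\mathsf{EPF} := \Sigma e : \mathbb{N} \to (\mathbb{N} \rightharpoonup \mathbb{N}).\ \forall f : \mathbb{N} \rightharpoonup \mathbb{N}.\ \exists n.\ e\,n \equiv_{\mathbb{N} \rightharpoonup \mathbb{N}} f$. Range equivalence of $f, g : \mathbb{N} \to \mathrm{option}\,\mathbb{N}$: $f \equiv_{\mathsf{ran}} g := \forall x.\ (\exists n.\ f\,n = \mathrm{Some}\,x) \leftrightarrow (\exists n.\ g\,n = \mathrm{Some}\,x)$. $\mathsf{EA} := \Sigma \varphi : \mathbb{N} \to (\mathbb{N} \to \mathrm{option}\,\mathbb{N}).\ \forall f : \mathbb{N} \to \mathrm{option}\,\mathbb{N}.\ \exists c.\ \varphi\,c \equiv_{\mathsf{ran}} f$. -}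

module Defs where

open import Data.Bool.Base using (Bool; true; false)
open import Data.Maybe.Base using (Maybe; just)
open import Data.Nat.Base using (ℕ; _<_)
open import Data.Product.Base using (Σ; ∃; _×_)
open import Function.Bundles using (_⇔_)
open import Level using (Level; _⊔_; 0ℓ; suc)
open import Relation.Binary.PropositionalEquality.Core using (_≡_)
open import Relation.Nullary using (¬_; Irrelevant)

private
  variable
    a p : Level
    A B : Set

-- Propositional existence must not give access to a witness as data, so it is
-- not Agda's Σ.  As in a theory with an impredicative universe of
-- propositions, it is the usual second-order encoding: ∃ x. P x holds when
-- every proposition that follows from P x for all x holds.  Propositions are
-- here the types with at most one element.

∥_∥ : Set a → Set (a ⊔ suc 0ℓ)
∥ A ∥ = (Q : Set) → Irrelevant Q → (A → Q) → Q

∃ₚ : {A : Set a} → (A → Set p) → Set (a ⊔ p ⊔ suc 0ℓ)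
∃ₚ P = ∥ ∃ P ∥

record Partiality : Set₁ where
  infix  4 _▷_
  infixl 1 _>>=_
  field
    ∂     : Set → Set
    _▷_   : ∂ A → A → Set
    ret   : A → ∂ A
    undef : ∂ A
    _>>=_ : ∂ A → (A → ∂ B) → ∂ B
    μ     : (ℕ → Bool) → ∂ ℕ
    seval : ∂ A → ℕ → Maybe A

    ▷-functional : {x : ∂ A} {a₁ a₂ : A} → x ▷ a₁ → x ▷ a₂ → a₁ ≡ a₂
    ret-▷   : (a : A) → ret a ▷ a
    undef-▷ : ¬ ∃ₚ λ (a : A) → undef ▷ a
    >>=-▷   : (x : ∂ A) (f : A → ∂ B) (b : B) →
              (x >>= f) ▷ b ⇔ ∃ₚ λ a → x ▷ a × f a ▷ b
    μ-▷     : (f : ℕ → Bool) (n : ℕ) →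
              μ f ▷ n ⇔ (f n ≡ true × (∀ m → m < n → f m ≡ false))
    seval-▷ : (x : ∂ A) (a : A) → x ▷ a ⇔ ∃ₚ λ n → seval x n ≡ just a

module _ (𝒫 : Partiality) where
  open Partiality 𝒫

  infixr 0 _⇀_
  _⇀_ : Set → Set → Set
  A ⇀ B = A → ∂ B

  PartialEq : (A ⇀ B) → (A ⇀ B) → Set
  PartialEq f g = ∀ x b → f x ▷ b ⇔ g x ▷ b

  EPF : Set₁
  EPF = Σ (ℕ → (ℕ ⇀ ℕ)) λ e → (f : ℕ ⇀ ℕ) → ∃ₚ λ n → PartialEq (e n) f

infix 4 _≡ran_
_≡ran_ : (ℕ → Maybe ℕ) → (ℕ → Maybe ℕ) → Set₁
f ≡ran g = ∀ x → (∃ₚ λ n → f n ≡ just x) ⇔ (∃ₚ λ n → g n ≡ just x)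

EA : Set₁
EA = Σ (ℕ → (ℕ → Maybe ℕ)) λ φ → (f : ℕ → Maybe ℕ) → ∃ₚ λ c → φ c ≡ran f

{-# OPTIONS --safe #-}

-- Partial functions correspond to the enumerable single-valued relations: a code c for the
-- graph of f, enumerated by dovetailing seval, computes f by searching φ c for the first
-- pair with the given first component. Single-valuedness makes the choice of pair irrelevant.
module Submission where

open import Defs
open import Data.Bool.Base using (Bool; true; false)
open import Data.Bool.Properties using (T-≡)
open import Data.Maybe.Base using (Maybe; just; map; maybe′)
open import Data.Nat.Base using (ℕ; zero; suc; _+_; _<_; _≡ᵇ_; s<s)
open import Data.Nat.Properties using (≡⇒≡ᵇ; ≡ᵇ⇒≡; +-identityʳ; +-suc; suc-injective)
open import Data.Product.Base using (∃; _×_; _,_; proj₁; proj₂)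
open import Function.Base using (_∘_)
open import Function.Bundles using (mk⇔; module Equivalence)
open import Level using (Level)
open import Relation.Binary.PropositionalEquality
  using (_≡_; refl; sym; trans; cong; cong₂; subst)

open Equivalence using (to; from)

private
  variable
    a b : Level

∣_∣ : {A : Set a} → A → ∥ A ∥
∣ x ∣ Q irr k = k x

∥∥-bind : {A : Set a} {B : Set b} → ∥ A ∥ → (A → ∥ B ∥) → ∥ B ∥
∥∥-bind t f Q irr k = t Q irr λ x → f x Q irr k

-- Cantor's walk: along an antidiagonal, then from its end `(x , zero)` to the start of the next
-- one.
step : ℕ × ℕ → ℕ × ℕ
step (x , zero)  = zero , suc x
step (x , suc y) = suc x , y

unpair : ℕ → ℕ × ℕ
unpair zero    = zero , zero
unpair (suc n) = step (unpair n)

-- Retraces the walk. The explicit `s` makes this terminate: each step back lowers `x` on the same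
-- diagonal, or lowers `s`.
unpair-surjective-on-diagonal : ∀ s x y → x + y ≡ s → ∃ λ n → unpair n ≡ (x , y)
unpair-surjective-on-diagonal s zero zero eq = zero , refl
unpair-surjective-on-diagonal (suc s) zero (suc y) eq =
  let n , p = unpair-surjective-on-diagonal s y zero (trans (+-identityʳ y) (suc-injective eq))
  in suc n , cong step p
unpair-surjective-on-diagonal s (suc x) y eq =
  let n , p = unpair-surjective-on-diagonal s x (suc y) (trans (+-suc x y) eq)
  in suc n , cong step p

pair : ℕ → ℕ → ℕ
pair x y = proj₁ (unpair-surjective-on-diagonal (x + y) x y refl)

unpair-pair : ∀ x y → unpair (pair x y) ≡ (x , y)
unpair-pair x y = proj₂ (unpair-surjective-on-diagonal (x + y) x y refl)

Least : (ℕ → Bool) → ℕ → Set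
Least p n = p n ≡ true × (∀ m → m < n → p m ≡ false)

-- The given witness `n` bounds the search; testing `zero` before shifting `p` by `suc` yields
-- minimality.
least : ∀ (p : ℕ → Bool) n → p n ≡ true → ∃ (Least p)
least p n pn with p zero in p0
... | true = zero , p0 , λ _ ()
least p zero    pn | false with () ← trans (sym p0) pn
least p (suc n) pn | false =
  let m , pm , below = least (p ∘ suc) n pn
  in suc m , pm , λ { zero _ → p0 ; (suc k) (s<s k<m) → below k k<m }

-- The default `false` ensures that an index found by `μ` carries a pair.
keyed : ℕ → Maybe ℕ → Bool
keyed x = maybe′ (λ z → proj₁ (unpair z) ≡ᵇ x) false

keyed-just : ∀ {x y z} → unpair z ≡ (x , y) → keyed x (just z) ≡ true
keyed-just {x} {z = z} eq = to T-≡ (≡⇒≡ᵇ (proj₁ (unpair z)) x (cong proj₁ eq))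

keyed-true : ∀ {x} w → keyed x w ≡ true → ∃ λ z → w ≡ just z × proj₁ (unpair z) ≡ x
keyed-true (just z) eq = z , refl , ≡ᵇ⇒≡ _ _ (from T-≡ eq)

module _ (𝒫 : Partiality) where
  open Partiality 𝒫

  retMaybe : Maybe ℕ → ∂ ℕ
  retMaybe = maybe′ (ret ∘ proj₂ ∘ unpair) undef

  evaluate : (ℕ → Maybe ℕ) → _⇀_ 𝒫 ℕ ℕ
  evaluate g x = μ (keyed x ∘ g) >>= (retMaybe ∘ g)

  evaluate-sound : ∀ g x b → evaluate g x ▷ b → ∃ₚ λ n → ∃ λ z → g n ≡ just z × unpair z ≡ (x , b)
  evaluate-sound g x b e▷b = ∥∥-bind (to (>>=-▷ _ _ b) e▷b) λ where
    (n , μ▷n , r▷b) →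
      let z , gn , key = keyed-true (g n) (proj₁ (to (μ-▷ _ n) μ▷n))
          z▷b = subst (λ w → retMaybe w ▷ b) gn r▷b
      in ∣ n , z , gn , cong₂ _,_ key (▷-functional (ret-▷ _) z▷b) ∣

  -- The value is some `b′`, not `b`: for arbitrary `g` an earlier entry may pair `x` with another
  -- value.
  evaluate-defined : ∀ g x {n z b} → g n ≡ just z → unpair z ≡ (x , b) → ∃ λ b′ → evaluate g x ▷ b′
  evaluate-defined g x {n} {z} gn eq =
    let m , pm , below = least (keyed x ∘ g) n (trans (cong (keyed x) gn) (keyed-just {z = z} eq))
        z′ , gm , _ = keyed-true (g m) pm
    in proj₂ (unpair z′) , from (>>=-▷ _ _ _)
         ∣ m , from (μ-▷ _ m) (pm , below)
         , subst (λ w → retMaybe w ▷ proj₂ (unpair z′)) (sym gm) (ret-▷ _) ∣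

  -- The index `k` encodes an input together with a step count for `seval`.
  graph : _⇀_ 𝒫 ℕ ℕ → ℕ → Maybe ℕ
  graph f k = let x , n = unpair k in map (pair x) (seval (f x) n)

  graph-complete : ∀ f x b → f x ▷ b → ∃ₚ λ k → graph f k ≡ just (pair x b)
  graph-complete f x b f▷b = ∥∥-bind (to (seval-▷ (f x) b) f▷b) λ (n , eq) →
    ∣ pair x n , trans (cong (λ (x , n) → map (pair x) (seval (f x) n)) (unpair-pair x n))
                       (cong (map (pair x)) eq) ∣

  graph-sound : ∀ f k {z x b} → graph f k ≡ just z → unpair z ≡ (x , b) → f x ▷ b
  graph-sound f k eq z≡ with unpair k
  ... | x′ , n with seval (f x′) n in ev
  graph-sound f k refl z≡ | x′ , n | just b′ with refl ← trans (sym (unpair-pair x′ b′)) z≡ =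
    from (seval-▷ _ _) ∣ n , ev ∣

  evaluate-graph : ∀ g f → g ≡ran graph f → PartialEq 𝒫 (evaluate g) f
  evaluate-graph g f g≡f x b = mk⇔ sound complete
    where
    -- f x ▷ c need not be a proposition, so truncations are eliminated through seval-▷.
    sound : ∀ {c} → evaluate g x ▷ c → f x ▷ c
    sound {c} e▷c = from (seval-▷ _ _) (∥∥-bind (evaluate-sound g x c e▷c)
      λ (n , z , gn , z≡) → ∥∥-bind (to (g≡f z) ∣ n , gn ∣)
      λ (k , fk) → to (seval-▷ _ _) (graph-sound f k fk z≡))

    complete : f x ▷ b → evaluate g x ▷ b
    complete f▷b = from (seval-▷ _ _) (∥∥-bind (graph-complete f x b f▷b)
      λ (k , fk) → ∥∥-bind (from (g≡f (pair x b)) ∣ k , fk ∣)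
      -- The search may stop at another pair, but `sound` at `b′` gives `f x ▷ b′`, so `b′` equals
      -- `b`.
      λ (n , gn) → let b′ , e▷b′ = evaluate-defined g x gn (unpair-pair x b) in
        to (seval-▷ _ _) (subst (evaluate g x ▷_) (▷-functional (sound e▷b′) f▷b) e▷b′))

theorem11 : (𝒫 : Partiality) → EA → EPF 𝒫
theorem11 𝒫 (φ , enumerates) = (λ c → evaluate 𝒫 (φ c)) , λ f →
  -- The evaluator is already fixed uniformly in `c`, so the code of `f` is extracted only for a
  -- truncated goal.
  ∥∥-bind (enumerates (graph 𝒫 f)) λ (c , φc≡f) → ∣ c , evaluate-graph 𝒫 (φ c) f φc≡f ∣
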